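{- Consider a feasible SM2-multi problem $\min f(X)$ subject to $a_{ij}x_i+b_{ij}x_j\ge c_{ij}$ for all $(i,j)\in A$, $0\le x_j\le u_j$ and $x_j$ integer for all $j\in V$, where $f$ is a nonnegative submodular function on multi-sets over $V$ with multiplicities bounded by $\mathbf{u}$. Let $(X'^+,X'^-)$ be a pair of multi-sets minimizing $g(X^+\cup X^-)=f(X^+)+f(X^-)$ among all pairs $(X^+,X^-)$ feasible for the relaxed (monotonized) SM2-multi problem. Let $S^*$ be a multi-set minimizing $f$ among all feasible solutions of the original SM2-multi problem. Then $$2f(S^*)\ \ge\ f(X'^+\cup X'^-),$$ where $X'^+\cup X'^-$ denotes the union taken in $V$ (coordinatewise maximum of the characteristic vectors).
   Context: Multi-sets: $V=\{1,\dots,n\}$ is a finite set and $\mathbf{u}=(u_j)_{j\in V}$ a vector of positive integers. An integer vector $\mathbf{x}$ with $0\le x_j\le u_j$ is the characteristic vector of the multi-set $X$ containing element $j$ exactly $x_j$ times. Containment, union and intersection of multi-sets are coordinatewise $\le$, maximum and minimum of characteristic vectors. A nonnegative real function $f$ on these multi-sets is submodular if $f(X)+f(Y)\ge f(X\cap Y)+f(X\cup Y)$ for all $X,Y$. (If all $u_j=1$, these are ordinary subsets of $V$.) SM2-multi: minimize $f(X)$ subject to $a_{ij}x_i+b_{ij}x_j\ge c_{ij}$ for $(i,j)\in A$, $0\le x_j\le u_j$, $\mathbf{x}$ integer, where $\mathbf x$ is the characteristic vector of $X$, $a_{ij},b_{ij},c_{ij}$ are real, and $A$ is a finite collection of pairs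 (singletons, i.e. one-variable constraints, and repeated pairs are allowed). A constraint is monotone if its two nonzero coefficients have opposite signs, i.e. it can be written $a'_{ij}x_i-b'_{ij}x_j\ge c'_{ij}$ with $a'_{ij},b'_{ij}$ of the same sign. Relaxed (monotonized) problem: take two copies $V^+,V^-$ of $V$ with integer variables $x_j^+\in\{0,1,\dots,u_j\}$ and $x_j^-\in\{ -u_j,\dots,-1,0\}$. Each non-monotone constraint $a_{ij}x_i+b_{ij}x_j\ge c_{ij}$ is replaced by the two constraints $a_{ij}x_i^+-b_{ij}x_j^-\ge c_{ij}$ and $-a_{ij}x_i^-+b_{ij}x_j^+\ge c_{ij}$; each monotone constraint $a'_{ij}x_i-b'_{ij}x_j\ge c'_{ij}$ is replaced by $a'_{ij}x_i^+-b'_{ij}x_j^+\ge c'_{ij}$ and $-a'_{ij}x_i^-+b'_{ij}x_j^-\ge c'_{ij}$. A one-variable constraint $a x_i\ge c$ becomes $a x_i^+\ge c$ and $-a x_i^-\ge c$. Put $\mathbf{x}'=-\mathbf{x}^-$. $X^+$ and $X^-$ are the multi-sets with characteristic vectors $\mathbf{x}^+$ and $\mathbf{x}'$; through the identification of $V^+$ and $V^-$ with $V$, both are multi-sets over $V$, so $f(X^+)$, $f(X^-)$ and $f(X^+\cup X^-)$ are defined. The pair $(X^+,X^-)$ is feasible if $(\mathbf{x}^+,\mathbf{x}^-)$ satisfies all replaced constraints. The objective of the relaxed problem is $g(X^+\cup X^-)=f(X^+)+f(X^-)$. -}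

module Defs where

open import Level using (suc; _⊔_)
open import Algebra.Apartness.Bundles using (HeytingField; HeytingCommutativeRing)
open import Algebra.Bundles using (CommutativeRing)
import Algebra.Properties.Semiring.Mult as Mult
open import Data.Fin using (Fin)
open import Data.Integer as ℤ using (ℤ; +_; -[1+_])
open import Data.List using (List)
open import Data.List.Relation.Unary.All using (All)
open import Data.Nat as ℕ using (ℕ)
import Data.Nat.Properties as ℕ
open import Data.Product using (∃-syntax; _×_)
open import Data.Sum using (_⊎_)
open import Data.Vec using (Vec; lookup; map; zipWith)
open import Data.Vec.Properties using (lookup-zipWith)
open import Relation.Binary using (Rel; IsStrictPartialOrder)
open import Relation.Binary.PropositionalEquality using (subst; sym)
open import Relation.Nullary using (¬_)

------------------------------------------------------------------------
-- Real numbers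

-- An ordered field in constructive form: the order is not assumed decidable,
-- and _≤_ is the negation of the converse strict order.
record OrderedField c ℓ₁ ℓ₂ : Set (suc (c ⊔ ℓ₁ ⊔ ℓ₂)) where
  infix 4 _<_ _≤_ _≥_

  field
    heytingField : HeytingField c ℓ₁ ℓ₂

  open HeytingField heytingField public

  field
    _<_                    : Rel Carrier ℓ₂
    <-isStrictPartialOrder : IsStrictPartialOrder _≈_ _<_
    #⇒<⊎>                  : ∀ {x y} → x # y → x < y ⊎ y < x
    <⇒#                    : ∀ {x y} → x < y → x # y
    +-monoʳ-<              : ∀ x {y z} → y < z → x + y < x + z
    *-pos                  : ∀ {x y} → 0# < x → 0# < y → 0# < x * y

  _≤_ _≥_ : Rel Carrier ℓ₂
  x ≤ y = ¬ (y < x)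
  x ≥ y = y ≤ x

  commutativeRing : CommutativeRing c ℓ₁
  commutativeRing = HeytingCommutativeRing.commutativeRing
    (HeytingField.heytingCommutativeRing heytingField)

  open Mult (CommutativeRing.semiring commutativeRing)
    using () renaming (_×_ to _times_)

  fromℤ : ℤ → Carrier
  fromℤ (+ n)    = n times 1#
  fromℤ -[1+ n ] = - (ℕ.suc n times 1#)

  IsCauchy : (ℕ → Carrier) → Set (c ⊔ ℓ₂)
  IsCauchy s = ∀ ε → 0# < ε →
    ∃[ N ] (∀ p q → N ℕ.≤ p → N ℕ.≤ q → s p - s q < ε)

  _ConvergesTo_ : (ℕ → Carrier) → Carrier → Set (c ⊔ ℓ₂)
  s ConvergesTo l = ∀ ε → 0# < ε →
    ∃[ N ] (∀ p → N ℕ.≤ p → (s p - l < ε) × (l - s p < ε))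

-- The standard library has no type of real numbers.  They are axiomatised
-- here as a Cauchy-complete Archimedean ordered field, which classically
-- determines them up to isomorphism.
record RealNumbers c ℓ₁ ℓ₂ : Set (suc (c ⊔ ℓ₁ ⊔ ℓ₂)) where
  field
    orderedField : OrderedField c ℓ₁ ℓ₂

  open OrderedField orderedField public

  field
    archimedean : ∀ x → ∃[ n ] (x < fromℤ (+ n))
    complete    : ∀ s → IsCauchy s → ∃[ l ] (s ConvergesTo l)

------------------------------------------------------------------------
-- Multi-sets

-- The bound is irrelevant, so multi-sets are equal as soon as their
-- characteristic vectors are.
record MultiSet {n} (u : Vec ℕ n) : Set where
  constructor multiSet
  field
    χ    : Vec ℕ n
    .χ≤u : ∀ j → lookup χ j ℕ.≤ lookup u j

open MultiSet public

module _ {n} {u : Vec ℕ n} where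

  infixr 7 _∩_
  infixr 6 _∪_

  _∪_ _∩_ : MultiSet u → MultiSet u → MultiSet u
  multiSet x x≤u ∪ multiSet y y≤u = multiSet (zipWith ℕ._⊔_ x y) λ j →
    subst (ℕ._≤ lookup u j) (sym (lookup-zipWith ℕ._⊔_ j x y))
      (ℕ.⊔-lub (x≤u j) (y≤u j))
  multiSet x x≤u ∩ multiSet y y≤u = multiSet (zipWith ℕ._⊓_ x y) λ j →
    subst (ℕ._≤ lookup u j) (sym (lookup-zipWith ℕ._⊓_ j x y))
      (ℕ.≤-trans (ℕ.m⊓n≤m (lookup x j) (lookup y j)) (x≤u j))

  -- The values of the variables x⁺ (and of the original variables x).
  positive : MultiSet u → Vec ℤ n
  positive X = map +_ (χ X)

  -- The values of the variables x⁻, which satisfy x′ = -x⁻ for the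
  -- characteristic vector x′ of X.
  negative : MultiSet u → Vec ℤ n
  negative X = map (λ k → ℤ.- (+ k)) (χ X)

------------------------------------------------------------------------
-- The problem SM2-multi and its monotonized relaxation

module SM2 {c ℓ₁ ℓ₂} (ℝ : RealNumbers c ℓ₁ ℓ₂) where

  open RealNumbers ℝ

  infixl 7 _·_

  _·_ : Carrier → ℤ → Carrier
  a · z = a * fromℤ z

  data Constraint (n : ℕ) : Set c where
    -- a x_i ≥ b
    one : (i : Fin n) (a b : Carrier) → Constraint n
    -- a x_i + b x_j ≥ d
    two : (i j : Fin n) (a b d : Carrier) → Constraint n

  Satisfies : ∀ {n} → Vec ℤ n → Constraint n → Set ℓ₂
  Satisfies x (one i a b)     = a · lookup x i ≥ b
  Satisfies x (two i j a b d) = a · lookup x i + b · lookup x j ≥ d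

  -- a x_i + b x_j ≥ d is monotone if a and b have opposite signs.
  Monotone : Carrier → Carrier → Set ℓ₂
  Monotone a b = (0# < a × b < 0#) ⊎ (a < 0# × 0# < b)

  -- The sign of real coefficients is not decidable constructively, so the
  -- replacement is selected by implications rather than by a case split.  A
  -- monotone a x_i + b x_j ≥ d is a′ x_i - b′ x_j ≥ d with a′ = a, b′ = - b.
  SatisfiesRelaxed : ∀ {n} → Vec ℤ n → Vec ℤ n → Constraint n → Set ℓ₂
  SatisfiesRelaxed x⁺ x⁻ (one i a b) =
    (a · lookup x⁺ i ≥ b) × ((- a) · lookup x⁻ i ≥ b)
  SatisfiesRelaxed x⁺ x⁻ (two i j a b d) =
    (Monotone a b →
      let a′ = a
          b′ = - b
      in (a′ · lookup x⁺ i - b′ · lookup x⁺ j ≥ d) ×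
         ((- a′) · lookup x⁻ i + b′ · lookup x⁻ j ≥ d)) ×
    (¬ Monotone a b →
      (a · lookup x⁺ i - b · lookup x⁻ j ≥ d) ×
      ((- a) · lookup x⁻ i + b · lookup x⁺ j ≥ d))

  Nonnegative : ∀ {n} {u : Vec ℕ n} → (MultiSet u → Carrier) → Set ℓ₂
  Nonnegative f = ∀ X → f X ≥ 0#

  Submodular : ∀ {n} {u : Vec ℕ n} → (MultiSet u → Carrier) → Set ℓ₂
  Submodular f = ∀ X Y → f X + f Y ≥ f (X ∩ Y) + f (X ∪ Y)

  record SM2-multi (n : ℕ) : Set (c ⊔ ℓ₂) where
    field
      u           : Vec ℕ n
      u-positive  : ∀ j → 0 ℕ.< lookup u j
      f           : MultiSet u → Carrier
      nonnegative : Nonnegative f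
      submodular  : Submodular f
      constraints : List (Constraint n)

    Feasible : MultiSet u → Set (c ⊔ ℓ₂)
    Feasible X = All (Satisfies (positive X)) constraints

    IsOptimal : MultiSet u → Set (c ⊔ ℓ₂)
    IsOptimal S = Feasible S × (∀ X → Feasible X → f S ≤ f X)

    RelaxedFeasible : MultiSet u → MultiSet u → Set (c ⊔ ℓ₂)
    RelaxedFeasible X⁺ X⁻ =
      All (SatisfiesRelaxed (positive X⁺) (negative X⁻)) constraints

    g : MultiSet u → MultiSet u → Carrier
    g X⁺ X⁻ = f X⁺ + f X⁻

    IsRelaxedOptimal : MultiSet u → MultiSet u → Set (c ⊔ ℓ₂)
    IsRelaxedOptimal X⁺ X⁻ = RelaxedFeasible X⁺ X⁻ ×
      (∀ Y⁺ Y⁻ → RelaxedFeasible Y⁺ Y⁻ → g X⁺ X⁻ ≤ g Y⁺ Y⁻)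

{-# OPTIONS --safe #-}
-- The pair (S*, S*) is feasible for the relaxed problem: x⁻ = - x⁺ turns each
-- replaced constraint back into the original one.  Optimality of (X⁺, X⁻),
-- submodularity and nonnegativity then give
--   2 f(S*) ≥ f(X⁺) + f(X⁻) ≥ f(X⁺ ∩ X⁻) + f(X⁺ ∪ X⁻) ≥ f(X⁺ ∪ X⁻).

module Submission where

open import Defs
open import Data.Nat using (ℕ; zero; suc)
open import Data.Product using (∃-syntax; _,_)
open import Algebra.Bundles using (CommutativeRing)
import Algebra.Properties.Ring as RingProperties
open import Data.Integer as ℤ using (+_)
import Data.List.Relation.Unary.All as All
open import Data.Sum using (inj₁; inj₂)
open import Data.Vec using (Vec; lookup)
open import Data.Vec.Properties using (lookup-map)
open import Relation.Binary using (IsStrictPartialOrder; Transitive)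
import Relation.Binary.PropositionalEquality as ≡
import Relation.Binary.Reasoning.Setoid as SetoidReasoning

module OrderedFieldProperties {c ℓ₁ ℓ₂} (F : OrderedField c ℓ₁ ℓ₂) where

  open OrderedField F
  open RingProperties (CommutativeRing.ring commutativeRing)
    using (-0#≈0#; -‿involutive; -‿distribˡ-*; -‿distribʳ-*)
  open SetoidReasoning (CommutativeRing.setoid commutativeRing)
  open IsStrictPartialOrder <-isStrictPartialOrder
    using (<-respˡ-≈; <-respʳ-≈)
    renaming (trans to <-trans)

  ≤-respˡ-≈ : ∀ {x y z} → x ≈ y → x ≤ z → y ≤ z
  ≤-respˡ-≈ x≈y x≤z z<y = x≤z (<-respʳ-≈ (sym x≈y) z<y)

  ≤-respʳ-≈ : ∀ {x y z} → x ≈ y → z ≤ x → z ≤ y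
  ≤-respʳ-≈ x≈y z≤x y<z = z≤x (<-respˡ-≈ (sym x≈y) y<z)

  -- As `_≤_` is a negation and `_<_` is not decidable, an assumed `z < x` is refuted by
  -- cotransitivity of apartness: `y` is apart from `z` or from `x`, and each resulting strict
  -- comparison contradicts one of the premises.
  ≤-trans : Transitive _≤_
  ≤-trans {x} {y} {z} x≤y y≤z z<x with #-cotrans (<⇒# z<x) y
  ... | inj₁ z#y with #⇒<⊎> z#y
  ...   | inj₁ z<y = y≤z z<y
  ...   | inj₂ y<z = x≤y (<-trans y<z z<x)
  ≤-trans {x} {y} {z} x≤y y≤z z<x | inj₂ y#x with #⇒<⊎> y#x
  ...   | inj₁ y<x = x≤y y<x
  ...   | inj₂ x<y = y≤z (<-trans z<x x<y)

  -- Adding `- y` to a supposed `x + y < y` would give `x < 0#`. This is what discards the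
  -- intersection term of submodularity.
  0≤x⇒y≤x+y : ∀ {x} y → 0# ≤ x → y ≤ x + y
  0≤x⇒y≤x+y {x} y 0≤x x+y<y =
    0≤x (<-respˡ-≈ lhs (<-respʳ-≈ (-‿inverseˡ y) (+-monoʳ-< (- y) x+y<y)))
    where
    lhs : - y + (x + y) ≈ x
    lhs = begin
      - y + (x + y)  ≈⟨ +-congˡ (+-comm x y) ⟩
      - y + (y + x)  ≈⟨ +-assoc (- y) y x ⟨
      - y + y + x    ≈⟨ +-congʳ (-‿inverseˡ y) ⟩
      0# + x         ≈⟨ +-identityˡ x ⟩
      x              ∎

  2*x≈x+x : ∀ x → (1# + 1#) * x ≈ x + x
  2*x≈x+x x = begin
    (1# + 1#) * x    ≈⟨ distribʳ x 1# 1# ⟩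
    1# * x + 1# * x  ≈⟨ +-cong (*-identityˡ x) (*-identityˡ x) ⟩
    x + x            ∎

  -- This and the next two identities are the sign patterns that arise in the replaced constraints
  -- once x⁻ = - x⁺.
  -x*-y≈x*y : ∀ x y → (- x) * (- y) ≈ x * y
  -x*-y≈x*y x y = begin
    (- x) * (- y)  ≈⟨ -‿distribʳ-* (- x) y ⟨
    - ((- x) * y)  ≈⟨ -‿cong (-‿distribˡ-* x y) ⟨
    - (- (x * y))  ≈⟨ -‿involutive (x * y) ⟩
    x * y          ∎

  -[x*-y]≈x*y : ∀ x y → - (x * (- y)) ≈ x * y
  -[x*-y]≈x*y x y = trans (-‿distribˡ-* x (- y)) (-x*-y≈x*y x y)

  -[-x*y]≈x*y : ∀ x y → - ((- x) * y) ≈ x * y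
  -[-x*y]≈x*y x y = trans (-‿distribʳ-* (- x) y) (-x*-y≈x*y x y)

  fromℤ-neg : ∀ n → fromℤ (ℤ.- (+ n)) ≈ - fromℤ (+ n)
  -- Integer negation computes only after a split on `n`; the successor case then holds by
  -- definition of `fromℤ`.
  fromℤ-neg zero    = sym -0#≈0#
  fromℤ-neg (suc n) = refl

module Relaxation {c ℓ₁ ℓ₂} (ℝ : RealNumbers c ℓ₁ ℓ₂) where

  open RealNumbers ℝ
  open SM2 ℝ
  open OrderedFieldProperties orderedField

  module _ {n} {u : Vec ℕ n} (X : MultiSet u) where

    negative≈-positive : ∀ i →
      fromℤ (lookup (negative X) i) ≈ - fromℤ (lookup (positive X) i)
    negative≈-positive i
      rewrite lookup-map i (λ k → ℤ.- (+ k)) (χ X)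
            | lookup-map i +_ (χ X) = fromℤ-neg (lookup (χ X) i)

    -a·negative≈a·positive : ∀ a i →
      (- a) · lookup (negative X) i ≈ a · lookup (positive X) i
    -a·negative≈a·positive a i =
      trans (*-congˡ (negative≈-positive i)) (-x*-y≈x*y a _)

    -[a·negative]≈a·positive : ∀ a i →
      - (a · lookup (negative X) i) ≈ a · lookup (positive X) i
    -[a·negative]≈a·positive a i =
      trans (-‿cong (*-congˡ (negative≈-positive i))) (-[x*-y]≈x*y a _)

    -- With one multi-set in both copies, every replaced left-hand side is ring-equal to the
    -- original one, so `s` transfers in the monotone and the non-monotone branch alike.
    satisfies⇒satisfiesRelaxed : ∀ {C} → Satisfies (positive X) C →
      SatisfiesRelaxed (positive X) (negative X) C
    satisfies⇒satisfiesRelaxed {one i a b} s =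
      s , ≤-respʳ-≈ (sym (-a·negative≈a·positive a i)) s
    satisfies⇒satisfiesRelaxed {two i j a b d} s =
      (λ _ →
        -- Here b′ = - b, so the subtracted term is a double negation of b x_j.
        ≤-respʳ-≈ (+-congˡ (sym (-[-x*y]≈x*y b _))) s ,
        ≤-respʳ-≈ (+-cong (sym (-a·negative≈a·positive a i))
                          (sym (-a·negative≈a·positive b j))) s) ,
      (λ _ →
        ≤-respʳ-≈ (+-congˡ (sym (-[a·negative]≈a·positive b j))) s ,
        ≤-respʳ-≈ (+-congʳ (sym (-a·negative≈a·positive a i))) s)

  module _ {n} (P : SM2-multi n) where

    open SM2-multi P

    feasible⇒relaxedFeasible : ∀ X → Feasible X → RelaxedFeasible X X
    feasible⇒relaxedFeasible X =
      -- `Satisfies` computes by cases on the constraint, so `C` cannot be recovered by unification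
      -- and is passed on.
      All.map (λ {C} → satisfies⇒satisfiesRelaxed X {C})

    f∪≤g : ∀ X Y → f (X ∪ Y) ≤ g X Y
    f∪≤g X Y = ≤-trans
      (0≤x⇒y≤x+y (f (X ∪ Y)) (nonnegative (X ∩ Y)))
      (submodular X Y)

theorem1 : ∀ {c ℓ₁ ℓ₂} (ℝ : RealNumbers c ℓ₁ ℓ₂) →
    let open RealNumbers ℝ
        open SM2 ℝ
    in
    (n : ℕ) (P : SM2-multi n) →
    let open SM2-multi P in
    (∃[ X ] Feasible X) →
    (X⁺ X⁻ : MultiSet u) → IsRelaxedOptimal X⁺ X⁻ →
    (S* : MultiSet u) → IsOptimal S* →
    (1# + 1#) * f S* ≥ f (X⁺ ∪ X⁻)
theorem1 ℝ n P _ X⁺ X⁻ (_ , minimal) S* (S*-feasible , _) =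
  ≤-respʳ-≈ (sym (2*x≈x+x (f S*)))
    (≤-trans (f∪≤g P X⁺ X⁻)
      -- The competitor is `S*` in both copies; `g S* S*` unfolds to `f S* + f S*`.
      (minimal S* S* (feasible⇒relaxedFeasible P S* S*-feasible)))
  where
  open RealNumbers ℝ
  open SM2.SM2-multi P
  open OrderedFieldProperties orderedField
  open Relaxation ℝ
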